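{- Let $m\ge 5$ be an integer and let $L_m$ be the ladder graph with $2$ rows and $m$ columns. Then $\mathrm{mpd}(L_m)=4$.
   Context: The ladder graph $L_m$ has vertex set $\{(x,y):x\in\{1,2\},\ 1\le y\le m\}$, with $(x,y)$ and $(x',y')$ adjacent if and only if $|x-x'|+|y-y'|=1$. $d(u,v)$ denotes the shortest-path distance. Let $G$ be a connected graph and let $\Pi=\{S_1,\dots,S_t\}$ be a partition of $V(G)$ into nonempty parts. For $v\in V(G)$ put $d(v,S_i)=\min\{d(v,x):x\in S_i\}$. The multiset partition representation of $v$ with respect to $\Pi$ is the multiset $r_{mp}(v\mid\Pi)=\{d(v,S_1),\dots,d(v,S_t)\}$ (order ignored, multiplicities kept). $\Pi$ is a resolving multiset partition if $r_{mp}(u\mid\Pi)\ne r_{mp}(v\mid\Pi)$ for all distinct $u,v\in V(G)$. The multiset partition dimension $\mathrm{mpd}(G)$ is the minimum number $t$ of parts of a resolving multiset partition of $G$, and $\mathrm{mpd}(G)=\infty$ if none exists. -}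

module Defs where

open import Data.Fin.Base using (Fin; zero; suc; toℕ; inject₁)
open import Data.Fin.Induction using (<-weakInduction)
open import Data.Fin.Properties using (toℕ-inject₁) renaming (_≟_ to _≟ᶠ_)
open import Data.List.Base using (List; allFin; cartesianProduct; tabulate)
open import Data.List.Membership.Propositional using (find; lose)
open import Data.List.Membership.Propositional.Properties using (∈-allFin; ∈-cartesianProduct⁺)
open import Data.List.Relation.Binary.Permutation.Propositional using (_↭_)
open import Data.List.Relation.Unary.Any using (any?)
open import Data.List.Relation.Unary.Enumerates.Setoid using (IsEnumeration)
open import Data.Nat.Base using (ℕ; zero; suc; _+_; _≤_; z≤n; s≤s; ∣_-_∣)
open import Data.Nat.Properties using (_≟_; ∣-∣-comm; ∣n-n∣≡0)
open import Data.Product.Base using (∃; ∃-syntax; _×_; _,_; proj₁; proj₂)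
open import Data.Product.Properties using (≡-dec)
open import Function.Base using (_∘_)
open import Level using (0ℓ)
open import Relation.Binary.Core using (Rel)
open import Relation.Binary.Definitions using (Symmetric; Irreflexive) renaming (Decidable to Decidable₂)
open import Relation.Binary.PropositionalEquality using (_≡_; _≢_; refl; sym; trans; cong₂; setoid)
open import Relation.Nullary.Construct.Add.Supremum using (_⁺; [_]; ⊤⁺)
open import Relation.Nullary.Decidable using (Dec; yes; no; map′; _×-dec_)
open import Relation.Nullary.Negation using (¬_; contradiction)
open import Relation.Unary using (Pred; Decidable)

IsMinimum : Pred ℕ 0ℓ → Pred ℕ 0ℓ
IsMinimum P m = P m × (∀ {k} → P k → m ≤ k)

minimum : {P : Pred ℕ 0ℓ} → Decidable P → ∀ {n} → P n → ∃ (IsMinimum P)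
minimum     P? {zero}  p = 0 , p , λ _ → z≤n
minimum {P} P? {suc n} p with P? 0
... | yes p₀ = 0 , p₀ , λ _ → z≤n
... | no ¬p₀ = let m , pₘ , m≤ = minimum (P? ∘ suc) {n} p in suc m , pₘ , bound m≤
  where
  bound : ∀ {m} → (∀ {k} → P (suc k) → m ≤ k) → ∀ {k} → P k → suc m ≤ k
  bound m≤ {zero}  p₀ = contradiction p₀ ¬p₀
  bound m≤ {suc k} pₖ = s≤s (m≤ pₖ)

record Graph : Set₁ where
  field
    Vertex     : Set
    vertices   : List Vertex
    enumerates : IsEnumeration (setoid Vertex) vertices
    _≟ᵛ_       : Decidable₂ (_≡_ {A = Vertex})
    Adjacent   : Rel Vertex 0ℓ
    adjacent?  : Decidable₂ Adjacent
    symmetric  : Symmetric Adjacent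
    loopless   : Irreflexive _≡_ Adjacent

  any-vertex? : {P : Pred Vertex 0ℓ} → Decidable P → Dec (∃ P)
  any-vertex? P? = map′ (λ a → let v , _ , p = find a in v , p)
                        (λ (v , p) → lose (enumerates v) p)
                        (any? P? vertices)

  data Walk : Vertex → Vertex → ℕ → Set where
    []  : ∀ {u} → Walk u u 0
    _∷_ : ∀ {u v w k} → Adjacent u v → Walk v w k → Walk u w (suc k)

  walk? : ∀ u w → Decidable (Walk u w)
  walk? u w zero    = map′ (λ { refl → [] }) (λ { [] → refl }) (u ≟ᵛ w)
  walk? u w (suc k) = map′ (λ (_ , a , p) → a ∷ p) (λ { (a ∷ p) → _ , a , p })
                           (any-vertex? λ v → adjacent? u v ×-dec walk? v w k)

  Connected : Set
  Connected = ∀ u v → ∃[ k ] Walk u v k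

module _ (G : Graph) (connected : Graph.Connected G) where
  open Graph G

  -- A shortest walk is a path, so this is the shortest-path distance.
  d : Vertex → Vertex → ℕ
  d u v = proj₁ (minimum (walk? u v) (proj₂ (connected u v)))

  -- The parts are S i = { v ∣ part v ≡ i }.  They are labelled by Fin t, but
  -- nothing below depends on the labelling.
  record Partition (t : ℕ) : Set where
    field
      part     : Vertex → Fin t
      nonempty : ∀ i → ∃[ v ] part v ≡ i

  module _ {t : ℕ} (Π : Partition t) where
    open Partition Π

    -- min { d v x ∣ x ∈ S i }
    dₛ : Vertex → Fin t → ℕ
    dₛ v i = proj₁ (minimum {P = λ k → ∃[ x ] part x ≡ i × d v x ≡ k}
      (λ k → any-vertex? λ x → (part x ≟ᶠ i) ×-dec (d v x ≟ k))
      (let x , x∈Sᵢ = nonempty i in x , x∈Sᵢ , refl))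

    -- Multisets are lists up to permutation, so representations are compared
    -- with _↭_.
    rₘₚ : Vertex → List ℕ
    rₘₚ v = tabulate (dₛ v)

    Resolving : Set
    Resolving = ∀ {u v} → u ≢ v → ¬ (rₘₚ u ↭ rₘₚ v)

  HasResolvingPartition : Pred ℕ 0ℓ
  HasResolvingPartition t = ∃[ Π ] Resolving {t} Π

  -- IsMpd x reads mpd(G) = x, where ⊤⁺ stands for ∞.
  IsMpd : Pred (ℕ ⁺) 0ℓ
  IsMpd [ t ] = IsMinimum HasResolvingPartition t
  IsMpd ⊤⁺    = ∀ t → ¬ HasResolvingPartition t

-- Coordinates count from 0 here rather than from 1; adjacency depends only on
-- coordinate differences.
ladder : ℕ → Graph
ladder m = record
  { Vertex     = Fin 2 × Fin m
  ; vertices   = cartesianProduct (allFin 2) (allFin m)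
  ; enumerates = λ (x , y) → ∈-cartesianProduct⁺ (∈-allFin x) (∈-allFin y)
  ; _≟ᵛ_       = ≡-dec _≟ᶠ_ _≟ᶠ_
  ; Adjacent   = λ (x , y) (x′ , y′) → gap x x′ + gap y y′ ≡ 1
  ; adjacent?  = λ (x , y) (x′ , y′) → gap x x′ + gap y y′ ≟ 1
  ; symmetric  = λ {(x , y)} {(x′ , y′)} →
      trans (cong₂ _+_ (∣-∣-comm (toℕ x′) (toℕ x)) (∣-∣-comm (toℕ y′) (toℕ y)))
  ; loopless   = λ { {x , y} refl e →
      contradiction (trans (sym (cong₂ _+_ (∣n-n∣≡0 (toℕ x)) (∣n-n∣≡0 (toℕ y)))) e) λ () }
  }
  where
  gap : ∀ {n} → Fin n → Fin n → ℕ
  gap i j = ∣ toℕ i - toℕ j ∣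

ladder-connected : ∀ m → Graph.Connected (ladder m)
ladder-connected zero    (_ , ())
ladder-connected (suc n) u v = ↝-trans (↝-sym (from-corner u)) (from-corner v)
  where
  open Graph (ladder (suc n))

  _↝_ : Rel Vertex 0ℓ
  u ↝ v = ∃[ k ] Walk u v k

  ↝-trans : ∀ {u v w} → u ↝ v → v ↝ w → u ↝ w
  ↝-trans (_ , [])    q = q
  ↝-trans (_ , a ∷ p) q = let k , r = ↝-trans (_ , p) q in suc k , a ∷ r

  ↝-sym : ∀ {u v} → u ↝ v → v ↝ u
  ↝-sym (_ , [])                = 0 , []
  ↝-sym (_ , _∷_ {u} {v} a p) =
    ↝-trans (↝-sym (_ , p)) (1 , symmetric {u} {v} a ∷ [])

  right : ∀ x (i : Fin n) → Adjacent (x , inject₁ i) (x , suc i)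
  right x i rewrite ∣n-n∣≡0 (toℕ x) | toℕ-inject₁ i = ∣n-1+n∣≡1 (toℕ i)
    where
    ∣n-1+n∣≡1 : ∀ k → ∣ k - suc k ∣ ≡ 1
    ∣n-1+n∣≡1 zero    = refl
    ∣n-1+n∣≡1 (suc k) = ∣n-1+n∣≡1 k

  from-corner : ∀ v → (zero , zero) ↝ v
  from-corner (x , y) = <-weakInduction (λ y → (zero , zero) ↝ (x , y)) (down x)
    (λ i p → ↝-trans p (1 , right x i ∷ [])) y
    where
    down : ∀ x → (zero , zero) ↝ (x , zero)
    down zero       = 0 , []
    down (suc zero) = 1 , refl ∷ []

{-# OPTIONS --safe #-}
module Submission where

-- Fewer than four parts never resolve a connected graph with two vertices.  For
-- three parts, call a vertex v with a neighbour in another part a boundary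
-- vertex; its representation is {0, 1, b}, where b is the distance to the third
-- part.  Take v with b minimal.  By minimality a geodesic from v to the third
-- part stays in the part of v until its last edge, so its last vertex in that
-- part is a boundary vertex with value ≤ b, hence equal to v.  So v has
-- neighbours in both other parts, b = 1, and both these neighbours are
-- represented by {0, 1, 2}.
--
-- Four parts suffice for the ladder: the first column, two single vertices of
-- the second row in columns 1 and 4 (counting from 0), and the rest.  The sum of
-- squares of the representation separates the vertices of the first five
-- columns, the sum separates all others and is larger there.

open import Defs
open import Data.Empty using (⊥; ⊥-elim)
open import Data.Fin.Base
  using (Fin; zero; suc; toℕ; inject₁; join; opposite; punchIn; punchOut; splitAt; _↑ˡ_; _↑ʳ_)
open import Data.Fin.Patterns
open import Data.Fin.Properties
  using (all?; join-splitAt; punchInᵢ≢i; punchIn-injective; punchIn-punchOut; punchOut-injective;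
         toℕ-inject₁; toℕ-injective)
  renaming (_≟_ to _≟ᶠ_)
open import Data.List.Base using (List; []; _∷_; map; tabulate)
open import Data.List.Properties using (tabulate-cong)
open import Data.List.Relation.Binary.Permutation.Propositional
  using (_↭_; prep; swap; ↭-refl; ↭-reflexive; ↭-sym; ↭-trans)
open import Data.List.Relation.Binary.Permutation.Propositional.Properties using (map⁺)
open import Data.Nat.Base using (ℕ; zero; suc; _+_; _*_; _≤_; _<_; z≤n; s≤s; ∣_-_∣)
open import Data.Nat.Induction using (<-rec)
open import Data.Nat.ListAction using (sum)
open import Data.Nat.ListAction.Properties using (sum-↭)
open import Data.Nat.Properties
open import Data.Nat.Tactic.RingSolver using (solve-∀)
open import Data.Product.Base using (∃; ∃-syntax; _×_; _,_; proj₁; proj₂; map₂)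
open import Data.Product.Properties using (≡-dec)
open import Data.Sum.Base using (inj₁; inj₂)
open import Function.Base using (_∘_; _$_)
open import Relation.Binary.PropositionalEquality
open import Relation.Nullary.Construct.Add.Supremum using ([_])
open import Relation.Nullary.Decidable using (yes; no; from-yes; decidable-stable; _×-dec_; _→-dec_)
open import Relation.Nullary.Negation using (¬_; contradiction)

-- Reordering tabulated entries, and the third element of `Fin 3`.

tabulate-↭ : ∀ {A : Set} {n} (f : Fin (suc n) → A) i → tabulate f ↭ f i ∷ tabulate (f ∘ punchIn i)
tabulate-↭ f zero = ↭-refl
tabulate-↭ {n = suc _} f (suc i) =
  ↭-trans (prep (f zero) (tabulate-↭ (f ∘ suc) i)) (swap (f zero) (f (suc i)) ↭-refl)

-- Serves to move the two known entries of a representation, 0 and 1, to the front; the nested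
-- `punchIn` runs through the remaining indices.
tabulate-↭₂ : ∀ {A : Set} {n} (f : Fin (suc (suc n)) → A) {i j} (i≢j : i ≢ j) →
  tabulate f ↭ f i ∷ f j ∷ tabulate (f ∘ punchIn i ∘ punchIn (punchOut i≢j))
tabulate-↭₂ f {i} {j} i≢j = ↭-trans (tabulate-↭ f i) $ prep (f i) $
  subst (λ k → _ ↭ f k ∷ tabulate (f ∘ punchIn i ∘ punchIn (punchOut i≢j)))
    (punchIn-punchOut i≢j) (tabulate-↭ (f ∘ punchIn i) (punchOut i≢j))

Fin₁-unique : (i j : Fin 1) → i ≡ j
Fin₁-unique zero zero = refl

third : {i j : Fin 3} → i ≢ j → Fin 3
third {i} i≢j = punchIn i (punchIn (punchOut i≢j) zero)

-- Deleting `i` and `j` from `Fin 3` leaves a copy of `Fin 1`, which has a single element.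
third-unique : ∀ {i j k : Fin 3} (i≢j : i ≢ j) → k ≢ i → k ≢ j → third i≢j ≡ k
third-unique {i} {j} {k} i≢j k≢i k≢j = trans (cong (punchIn i) eq) (punchIn-punchOut i≢k)
  where
  i≢k : i ≢ k
  i≢k = k≢i ∘ sym

  j′≢k′ : punchOut i≢j ≢ punchOut i≢k
  j′≢k′ e = k≢j (sym (punchOut-injective i≢j i≢k e))

  eq : punchIn (punchOut i≢j) zero ≡ punchOut i≢k
  eq = trans (cong (punchIn (punchOut i≢j)) (Fin₁-unique zero _)) (punchIn-punchOut j′≢k′)

third≢₁ : ∀ {i j : Fin 3} (i≢j : i ≢ j) → third i≢j ≢ i
third≢₁ {i} i≢j = punchInᵢ≢i i _

third≢₂ : ∀ {i j : Fin 3} (i≢j : i ≢ j) → third i≢j ≢ j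
third≢₂ {i} i≢j e = punchInᵢ≢i (punchOut i≢j) zero
  (punchIn-injective i _ _ (trans e (sym (punchIn-punchOut i≢j))))

-- Distances to the parts in a connected graph.

module _ (G : Graph) (connected : Graph.Connected G) where
  open Graph G

  module _ {t} (Π : Partition G connected t) where
    open Partition Π

    private
      δ : Vertex → Fin t → ℕ
      δ = dₛ G connected Π

      rep : Vertex → List ℕ
      rep = rₘₚ G connected Π

    d-minimum : ∀ u v → IsMinimum (Walk u v) (d G connected u v)
    d-minimum u v = proj₂ (minimum (walk? u v) (proj₂ (connected u v)))

    dₛ-minimum : ∀ v i → IsMinimum (λ k → ∃[ x ] part x ≡ i × d G connected v x ≡ k) (δ v i)
    dₛ-minimum v i = proj₂ (minimum
      (λ k → any-vertex? λ x → (part x ≟ᶠ i) ×-dec (d G connected v x ≟ k))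
      (let x , x∈i = nonempty i in x , x∈i , refl))

    nearest : ∀ v i → ∃[ x ] part x ≡ i × Walk v x (δ v i)
    nearest v i = let x , x∈i , d≡δ = proj₁ (dₛ-minimum v i) in
      x , x∈i , subst (Walk v x) d≡δ (proj₁ (d-minimum v x))

    dₛ-≤ : ∀ {v x i k} → part x ≡ i → Walk v x k → δ v i ≤ k
    dₛ-≤ {v} {x} {i} x∈i p =
      ≤-trans (proj₂ (dₛ-minimum v i) (x , x∈i , refl)) (proj₂ (d-minimum v x) p)

    dₛ-own : ∀ v → δ v (part v) ≡ 0
    dₛ-own v = n≤0⇒n≡0 (dₛ-≤ refl [])

    dₛ≡0⇒part : ∀ {v i} → δ v i ≡ 0 → part v ≡ i
    dₛ≡0⇒part {v} {i} e with nearest v i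
    ... | x , x∈i , p with δ v i | p
    ... | 0 | [] = x∈i

    dₛ-foreign : ∀ {v i} → i ≢ part v → 1 ≤ δ v i
    dₛ-foreign i≢v = n≢0⇒n>0 (i≢v ∘ sym ∘ dₛ≡0⇒part)

    dₛ-adjacent : ∀ {v w} → Adjacent v w → part v ≢ part w → δ v (part w) ≡ 1
    dₛ-adjacent a v≢w = ≤-antisym (dₛ-≤ refl (a ∷ [])) (dₛ-foreign (v≢w ∘ sym))

    rₘₚ-injective : Resolving G connected Π → ∀ {u v} → rep u ↭ rep v → u ≡ v
    rₘₚ-injective resolving {u} {v} p = decidable-stable (u ≟ᵛ v) λ u≢v → resolving u≢v p

    -- Along an edge `f` drops by at most one, so no walk to the part is shorter than `f v`;
    -- descending one unit at a time yields a walk of exactly that length. Distances are thus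
    -- identified without evaluating the searches behind `dₛ`.
    dₛ-unique : ∀ (f : Vertex → ℕ) i →
      (∀ {u v} → Adjacent u v → f u ≤ suc (f v)) →
      (∀ {v} → part v ≡ i → f v ≡ 0) →
      (∀ {v} → f v ≡ 0 → part v ≡ i) →
      (∀ {v k} → f v ≡ suc k → ∃[ w ] Adjacent v w × f w ≡ k) →
      ∀ v → δ v i ≡ f v
    dₛ-unique f i lipschitz vanishes part-of descends v =
      let x , x∈i , p = nearest v i ; y , y∈i , q = descent (f v) refl in
      ≤-antisym (dₛ-≤ y∈i q) (ascent x∈i p)
      where
      ascent : ∀ {v x k} → part x ≡ i → Walk v x k → f v ≤ k
      ascent x∈i []      = ≤-reflexive (vanishes x∈i)
      ascent x∈i (a ∷ p) = ≤-trans (lipschitz a) (s≤s (ascent x∈i p))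

      descent : ∀ k {v} → f v ≡ k → ∃[ x ] part x ≡ i × Walk v x k
      descent zero    e = _ , part-of e , []
      descent (suc k) e = let w , a , e′ = descends e ; x , x∈i , p = descent k e′ in x , x∈i , a ∷ p

    boundary-edge : ∀ {u v k} → Walk u v k → part u ≢ part v →
      ∃[ p ] ∃[ q ] Adjacent p q × part p ≢ part q
    boundary-edge []              u≢u = contradiction refl u≢u
    boundary-edge (_∷_ {u} {w} a p) u≢v with part u ≟ᶠ part w
    ... | no u≢w  = u , w , a , u≢w
    ... | yes u≡w = boundary-edge p (u≢v ∘ trans u≡w)

  -- Lower bound: one or two parts.

  exists-boundary-edge : ∀ {t} (Π : Partition G connected (suc (suc t))) → let open Partition Π in
    ∃[ p ] ∃[ q ] Adjacent p q × part p ≢ part q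
  exists-boundary-edge Π = let u , u∈0 = nonempty zero ; v , v∈1 = nonempty (suc zero) in
    boundary-edge Π (proj₂ (connected u v)) λ e → contradiction (trans (sym u∈0) (trans e v∈1)) λ ()
    where open Partition Π

  adjacent⇒≢ : ∀ {u v} → Adjacent u v → u ≢ v
  adjacent⇒≢ a u≡v = loopless u≡v a

  ¬resolving₁ : ∀ {u v} → u ≢ v → (Π : Partition G connected 1) → ¬ Resolving G connected Π
  ¬resolving₁ {u} {v} u≢v Π resolving =
    resolving u≢v (↭-reflexive (cong (_∷ []) (trans (zeros u) (sym (zeros v)))))
    where
    zeros : ∀ v → dₛ G connected Π v zero ≡ 0
    zeros v = subst (λ i → dₛ G connected Π v i ≡ 0) (Fin₁-unique _ _) (dₛ-own Π v)

  -- Both ends of an edge between the two parts are represented by 0 and 1.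
  ¬resolving₂ : (Π : Partition G connected 2) → ¬ Resolving G connected Π
  ¬resolving₂ Π resolving =
    let p , q , a , p≢q = exists-boundary-edge Π in
    resolving (adjacent⇒≢ a)
      (↭-trans (rep₂ a p≢q) (↭-sym (rep₂ (symmetric a) (p≢q ∘ sym))))
    where
    open Partition Π
    rep₂ : ∀ {p q} → Adjacent p q → part p ≢ part q → rₘₚ G connected Π p ↭ 0 ∷ 1 ∷ []
    rep₂ {p} a p≢q = ↭-trans (tabulate-↭₂ (dₛ G connected Π p) p≢q)
      (↭-reflexive (cong₂ (λ a b → a ∷ b ∷ []) (dₛ-own Π p) (dₛ-adjacent Π a p≢q)))

  -- Lower bound: three parts.

  module _ (Π : Partition G connected 3) (resolving : Resolving G connected Π) where
    open Partition Π

    private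
      δ : Vertex → Fin 3 → ℕ
      δ = dₛ G connected Π

    -- The third part `k` is an index, so that it can stay fixed while the edge varies;
    -- `third-unique` identifies it with `third v≢w`.
    record Boundary (v w : Vertex) (k : Fin 3) : Set where
      constructor boundary
      field
        adjacent : Adjacent v w
        v≢w      : part v ≢ part w
        k≢v      : k ≢ part v
        k≢w      : k ≢ part w

    open Boundary

    flip : ∀ {v w k} → Boundary v w k → Boundary w v k
    flip (boundary a v≢w k≢v k≢w) = boundary (symmetric a) (v≢w ∘ sym) k≢w k≢v

    rep-boundary : ∀ {v w k} → Boundary v w k → rₘₚ G connected Π v ↭ 0 ∷ 1 ∷ δ v k ∷ []
    rep-boundary {v} {w} (boundary a v≢w k≢v k≢w) =
      ↭-trans (tabulate-↭₂ (δ v) v≢w) $ ↭-reflexive $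
      cong₂ _∷_ (dₛ-own Π v) $ cong₂ _∷_ (dₛ-adjacent Π a v≢w) $
      cong (λ i → δ v i ∷ []) (third-unique v≢w k≢v k≢w)

    -- The multiset forgets which part contributes which entry, so equal values force equal vertices
    -- even when `k` and `k′` differ.
    boundary-injective : ∀ {v w k v′ w′ k′} →
      Boundary v w k → Boundary v′ w′ k′ → δ v k ≡ δ v′ k′ → v ≡ v′
    boundary-injective b b′ e = rₘₚ-injective Π resolving $
      ↭-trans (rep-boundary b) $ ↭-trans (↭-reflexive (cong (λ n → 0 ∷ 1 ∷ n ∷ []) e)) $ ↭-sym (rep-boundary b′)

    -- The detour through `v` gives at most 2, and the value 1 would give `w` the representation of
    -- `v`.
    next-to-junction : ∀ {v w k} → Boundary v w k → δ v k ≡ 1 →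
      ∀ {z} → Adjacent v z → part z ≡ k → δ w k ≡ 2
    next-to-junction b e a z∈k = ≤-antisym (dₛ-≤ Π z∈k (symmetric (adjacent b) ∷ a ∷ []))
      (≤∧≢⇒< (dₛ-foreign Π (k≢w b)) λ 1≡δ →
        adjacent⇒≢ (adjacent b) (boundary-injective b (flip b) (trans e 1≡δ)))

    -- Both `p` and `z` would be boundary vertices with value 2, hence equal, although their parts
    -- differ.
    no-junction : ∀ {v p z} → Adjacent v p → Adjacent v z →
      part v ≢ part p → part v ≢ part z → part p ≢ part z → ⊥
    no-junction {v} {p} {z} a a′ v≢p v≢z p≢z =
      p≢z $ cong part $ boundary-injective (flip b) (flip b′) $
      trans (next-to-junction b (dₛ-adjacent Π a′ v≢z) a′ refl)
        (sym (next-to-junction b′ (dₛ-adjacent Π a v≢p) a refl))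
      where
      b : Boundary v p (part z)
      b = boundary a v≢p (v≢z ∘ sym) (p≢z ∘ sym)

      b′ : Boundary v z (part p)
      b′ = boundary a′ v≢z (v≢p ∘ sym) p≢z

    -- A walk from part v to part k that strays into the third part does so at
    -- a boundary vertex closer to part k.  The walk back to p grows as the one
    -- to part k shrinks, so i + j is constant and no walk has to be reversed.
    last-edge : ∀ n {v p k} → k ≢ part v →
      (∀ {u q} → Boundary u q k → ¬ δ u k < n) →
      ∀ {u z i j} → part u ≡ part v → part z ≡ k →
      Walk u p i → Walk u z j → i + j ≤ suc n → j ≤ n →
      ∃[ x ] ∃[ y ] part x ≡ part v × part y ≡ k × Adjacent x y × δ x (part p) ≤ n
    last-edge n k≢v far u∈v z∈k q [] _ _ = contradiction (trans (sym z∈k) u∈v) k≢v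
    last-edge n {v} {p} {k} k≢v far {u} {i = i} u∈v z∈k q (_∷_ {v = w} {k = j} a r) i+j≤n j≤n
      with part w ≟ᶠ k | part w ≟ᶠ part v
    -- The edge into part `k` uses up one of the `suc n` steps, so the walk `q` back to `p` has
    -- length at most `n`.
    ... | yes w∈k | _ = u , w , u∈v , w∈k , a ,
      ≤-trans (dₛ-≤ Π refl q) (≤-pred (≤-trans (s≤s (m≤m+n i j)) (subst (_≤ suc n) (+-suc i j) i+j≤n)))
    ... | no _ | yes w∈v = last-edge n k≢v far w∈v z∈k (symmetric a ∷ q) r
      (subst (_≤ suc n) (+-suc i j) i+j≤n) (<⇒≤ j≤n)
    ... | no w∉k | no w∉v = contradiction (≤-<-trans (dₛ-≤ Π z∈k r) j≤n) $ far $
      boundary {w = u} (symmetric a) (λ w∈u → w∉v (trans w∈u u∈v)) (w∉k ∘ sym) (λ k≡u → k≢v (trans k≡u u∈v))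

    -- Strong induction on the value replaces the choice of a minimal one: the induction hypothesis
    -- excludes all smaller values, whichever part is the third.
    no-boundary : ∀ n {v p k} → Boundary v p k → δ v k ≢ n
    no-boundary = <-rec _ step
      where
      step : ∀ n → (∀ {m} → m < n → ∀ {v p k} → Boundary v p k → δ v k ≢ m) →
        ∀ {v p k} → Boundary v p k → δ v k ≢ n
      step n ih {v} {p} {k} b@(boundary a v≢p k≢v k≢p) refl =
        let z , z∈k , r = nearest Π v k
            x , y , x∈v , y∈k , a′ , δx≤n =
              -- The walk back to `p` starts as the single edge `a`, which makes the constant sum of
              -- lengths `suc n`.
              last-edge n k≢v (λ b δ<n → ih δ<n b refl) refl z∈k (a ∷ []) r ≤-refl ≤-refl
            -- At `x` the edge leads into part `k`, so the third part is now that of `p`. The value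
            -- there is at most `n` by the walk and at least `n` by `ih`.
            b′ = boundary a′ (λ e → k≢v (trans (sym y∈k) (trans (sym e) x∈v)))
                   (λ e → v≢p (sym (trans e x∈v))) (λ e → k≢p (sym (trans e y∈k)))
            x≡v = boundary-injective b′ b (≤-antisym δx≤n (≮⇒≥ λ δ<n → ih δ<n b′ refl))
        in no-junction a (subst (λ x → Adjacent x y) x≡v a′) v≢p
             (λ e → k≢v (sym (trans e y∈k))) (λ e → k≢p (sym (trans e y∈k)))

  ¬resolving₃ : (Π : Partition G connected 3) → ¬ Resolving G connected Π
  ¬resolving₃ Π resolving =
    let p , q , a , p≢q = exists-boundary-edge Π in
    no-boundary Π resolving _ (boundary a p≢q (third≢₁ p≢q) (third≢₂ p≢q)) refl

  4≤resolving : ∀ {u v} → u ≢ v → ∀ {t} → HasResolvingPartition G connected t → 4 ≤ t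
  4≤resolving {u} u≢v {0} (Π , _) with Partition.part Π u
  ... | ()
  4≤resolving u≢v {1} (Π , r) = ⊥-elim (¬resolving₁ u≢v Π r)
  4≤resolving u≢v {2} (Π , r) = ⊥-elim (¬resolving₂ Π r)
  4≤resolving u≢v {3} (Π , r) = ⊥-elim (¬resolving₃ Π r)
  4≤resolving u≢v {suc (suc (suc (suc t)))} _ = s≤s (s≤s (s≤s (s≤s z≤n)))

-- Manhattan distance on the ladder.

Fin-step : ∀ {n} (i j : Fin n) {k} → ∣ toℕ i - toℕ j ∣ ≡ suc k →
  ∃ λ (i′ : Fin n) → ∣ toℕ i - toℕ i′ ∣ ≡ 1 × ∣ toℕ i′ - toℕ j ∣ ≡ k
Fin-step {suc (suc _)} zero (suc j) refl = suc zero , refl , refl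
Fin-step (suc i) zero refl =
  inject₁ i , trans (cong ∣ suc (toℕ i) -_∣ (toℕ-inject₁ i)) (∣1+n-n∣≡1 (toℕ i)) ,
  trans (∣-∣-identityʳ _) (toℕ-inject₁ i)
  where
  ∣1+n-n∣≡1 : ∀ n → ∣ suc n - n ∣ ≡ 1
  ∣1+n-n∣≡1 zero    = refl
  ∣1+n-n∣≡1 (suc n) = ∣1+n-n∣≡1 n
Fin-step (suc i) (suc j) e = let i′ , e₁ , e₂ = Fin-step i j e in suc i′ , e₁ , e₂

-- Has the same form as adjacency in `ladder`, so that `Adjacent u v` unfolds to
-- `manhattan u v ≡ 1`.
manhattan : ∀ {m} → Fin 2 × Fin m → Fin 2 × Fin m → ℕ
manhattan (x , y) (x′ , y′) = ∣ toℕ x - toℕ x′ ∣ + ∣ toℕ y - toℕ y′ ∣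

manhattan-triangle : ∀ {m} (u v w : Fin 2 × Fin m) → manhattan u w ≤ manhattan u v + manhattan v w
manhattan-triangle (x , y) (x′ , y′) (x″ , y″) =
  ≤-trans (+-mono-≤ (∣-∣-triangle (toℕ x) (toℕ x′) (toℕ x″)) (∣-∣-triangle (toℕ y) (toℕ y′) (toℕ y″)))
    (≤-reflexive (interchange ∣ toℕ x - toℕ x′ ∣ _ _ _))
  where
  interchange : ∀ a b c e → (a + b) + (c + e) ≡ (a + c) + (b + e)
  interchange = solve-∀

manhattan≡0⇒≡ : ∀ {m} (u v : Fin 2 × Fin m) → manhattan u v ≡ 0 → u ≡ v
manhattan≡0⇒≡ (x , y) (x′ , y′) e = cong₂ _,_
  (toℕ-injective (∣m-n∣≡0⇒m≡n (m+n≡0⇒m≡0 _ e)))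
  (toℕ-injective (∣m-n∣≡0⇒m≡n (m+n≡0⇒n≡0 ∣ toℕ x - toℕ x′ ∣ e)))

manhattan-step : ∀ {m} (u v : Fin 2 × Fin m) {k} → manhattan u v ≡ suc k →
  ∃ λ (w : Fin 2 × Fin m) → manhattan u w ≡ 1 × manhattan w v ≡ k
manhattan-step (x , y) (x′ , y′) e with ∣ toℕ x - toℕ x′ ∣ in eq
... | zero = let y″ , e₁ , e₂ = Fin-step y y′ e in
  (x , y″) , cong₂ _+_ (∣n-n∣≡0 (toℕ x)) e₁ , cong₂ _+_ eq e₂
... | suc _ = let x″ , e₁ , e₂ = Fin-step x x′ eq in
  (x″ , y) , cong₂ _+_ e₁ (∣n-n∣≡0 (toℕ y)) , trans (cong (_+ _) e₂) (suc-injective e)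

-- Upper bound: a resolving partition of the ladder into four parts.

pattern 5+_ j = suc (suc (suc (suc (suc j))))

module FourParts (n : ℕ) where
  open Graph (ladder (5 + n)) using (Vertex; Adjacent)

  private
    a b : Vertex
    a = 1F , 1F
    b = 1F , 4F

  part : Vertex → Fin 4
  part (_  , 0F) = 0F
  part (1F , 1F) = 1F
  part (1F , 4F) = 2F
  part _         = 3F

  Π : Partition (ladder (5 + n)) (ladder-connected (5 + n)) 4
  Π = record
    { part     = part
    ; nonempty = λ
      { 0F → (0F , 0F) , refl
      ; 1F → a , refl
      ; 2F → b , refl
      ; 3F → (0F , 1F) , refl
      }
    }

  to-rest : Vertex → ℕ
  to-rest (0F , 0F) = 1
  -- Both neighbours of this corner, `(0F , 0F)` and `a`, lie outside the rest.
  to-rest (1F , 0F) = 2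
  to-rest (1F , 1F) = 1
  to-rest (1F , 4F) = 1
  to-rest _         = 0

  -- Candidate closed forms; `dₛ-unique` shows that they are the true distances.
  dist : Vertex → Fin 4 → ℕ
  dist (_ , y) 0F = toℕ y
  dist v       1F = manhattan v a
  dist v       2F = manhattan v b
  dist v       3F = to-rest v

  dist-part : ∀ v → dist v (part v) ≡ 0
  dist-part (_  , 0F)    = refl
  dist-part (0F , suc _) = refl
  dist-part (1F , 1F)    = refl
  dist-part (1F , 2F)    = refl
  dist-part (1F , 3F)    = refl
  dist-part (1F , 4F)    = refl
  dist-part (1F , 5+ _)  = refl

  dist≡0⇒part : ∀ v i → dist v i ≡ 0 → part v ≡ i
  dist≡0⇒part (_ , 0F)     0F _ = refl
  dist≡0⇒part v            1F e = cong part (manhattan≡0⇒≡ v a e)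
  dist≡0⇒part v            2F e = cong part (manhattan≡0⇒≡ v b e)
  dist≡0⇒part (0F , 0F)    3F ()
  dist≡0⇒part (1F , 0F)    3F ()
  dist≡0⇒part (0F , suc _) 3F _ = refl
  dist≡0⇒part (1F , 2F)    3F _ = refl
  dist≡0⇒part (1F , 3F)    3F _ = refl
  dist≡0⇒part (1F , 5+ _)  3F _ = refl

  manhattan-lipschitz : ∀ u v w → Adjacent u v → manhattan u w ≤ suc (manhattan v w)
  manhattan-lipschitz u v w u~v =
    subst (λ k → manhattan u w ≤ k + manhattan v w) u~v (manhattan-triangle u v w)

  dist-lipschitz : ∀ u v i → Adjacent u v → dist u i ≤ suc (dist v i)
  dist-lipschitz (x , y) (x′ , y′) 0F u~v = begin
    toℕ y                                ≤⟨ m≤∣m-n∣+n (toℕ y) (toℕ y′) ⟩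
    ∣ toℕ y - toℕ y′ ∣ + toℕ y′          ≤⟨ +-monoˡ-≤ (toℕ y′) (m≤n+m _ ∣ toℕ x - toℕ x′ ∣) ⟩
    manhattan (x , y) (x′ , y′) + toℕ y′ ≡⟨ cong (_+ toℕ y′) u~v ⟩
    suc (toℕ y′)                         ∎
    where open ≤-Reasoning
  dist-lipschitz u v 1F u~v = manhattan-lipschitz u v a u~v
  dist-lipschitz u v 2F u~v = manhattan-lipschitz u v b u~v
  dist-lipschitz (0F , 0F)    _            3F _ = s≤s z≤n
  dist-lipschitz (0F , suc _) _            3F _ = z≤n
  -- The only vertex with value 2: its neighbours must have value at least 1, and the two listed are
  -- all it has.
  dist-lipschitz (1F , 0F)    (0F , 0F)    3F _ = s≤s (s≤s z≤n)
  dist-lipschitz (1F , 0F)    (1F , 1F)    3F _ = s≤s (s≤s z≤n)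
  dist-lipschitz (1F , 1F)    _            3F _ = s≤s z≤n
  dist-lipschitz (1F , 2F)    _            3F _ = z≤n
  dist-lipschitz (1F , 3F)    _            3F _ = z≤n
  dist-lipschitz (1F , 4F)    _            3F _ = s≤s z≤n
  dist-lipschitz (1F , 5+ _)  _            3F _ = z≤n

  dist-descends : ∀ v i {k} → dist v i ≡ suc k → ∃[ w ] Adjacent v w × dist w i ≡ k
  dist-descends (x , suc y)  0F refl = let y′ , e₁ , e₂ = Fin-step (suc y) 0F refl in
    (x , y′) , cong₂ _+_ (∣n-n∣≡0 (toℕ x)) e₁ , trans (sym (∣-∣-identityʳ _)) e₂
  dist-descends v            1F e    = manhattan-step v a e
  dist-descends v            2F e    = manhattan-step v b e
  dist-descends (0F , 0F)    3F refl = (0F , 1F) , refl , refl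
  dist-descends (1F , 0F)    3F refl = (0F , 0F) , refl , refl
  dist-descends (1F , 1F)    3F refl = (0F , 1F) , refl , refl
  dist-descends (1F , 4F)    3F refl = (1F , 3F) , refl , refl

  profile : Vertex → List ℕ
  profile v = tabulate (dist v)

  rₘₚ≡profile : ∀ v → rₘₚ (ladder (5 + n)) (ladder-connected (5 + n)) Π v ≡ profile v
  rₘₚ≡profile v = tabulate-cong λ i →
    dₛ-unique (ladder (5 + n)) (ladder-connected (5 + n)) Π (λ v → dist v i) i
      (λ {u} {v} → dist-lipschitz u v i)
      (λ {v} e → subst (λ j → dist v j ≡ 0) e (dist-part v))
      (λ {v} → dist≡0⇒part v i)
      (λ {v} → dist-descends v i)
      v

  total energy : Vertex → ℕ
  total  v = sum (profile v)
  energy v = sum (map (λ k → k * k) (profile v))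

  -- The profiles of the first five columns do not depend on `n`, so a finite check decides this.
  -- Sums alone would not do: `(0F , 0F)` and `(0F , 3F)` both have sum 8.
  energy-injective : ∀ x (j : Fin 5) x′ (j′ : Fin 5) →
    energy (x , j ↑ˡ n) ≡ energy (x′ , j′ ↑ˡ n) → (x , j) ≡ (x′ , j′)
  energy-injective = from-yes $
    all? λ x → all? λ j → all? λ x′ → all? λ j′ →
      (energy (x , j ↑ˡ n) ≟ energy (x′ , j′ ↑ˡ n)) →-dec ≡-dec _≟ᶠ_ _≟ᶠ_ (x , j) (x′ , j′)

  total-near : ∀ x (j : Fin 5) → total (x , j ↑ˡ n) ≤ 9
  total-near = from-yes $ all? λ x → all? λ j → total (x , j ↑ˡ n) ≤? 9

  -- Each further column adds 1 to three distances and leaves the fourth at 0; the first row is one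
  -- step further from both `a` and `b`, whence the 2.
  total-far : ∀ x (j : Fin n) → total (x , 5 ↑ʳ j) ≡ 10 + (2 * toℕ (opposite x) + toℕ j * 3)
  total-far 0F j = eq (toℕ j)
    where
    eq : ∀ k → (5 + k) + ((5 + k) + ((2 + k) + 0)) ≡ 10 + (2 + k * 3)
    eq = solve-∀
  total-far 1F j = eq (toℕ j)
    where
    eq : ∀ k → (5 + k) + ((4 + k) + ((1 + k) + 0)) ≡ 10 + k * 3
    eq = solve-∀

  -- The residue modulo 3, which is 2 or 0, tells the rows apart; the mixed cases strip off 3 until
  -- one column index is zero.
  2*+*3-injective : ∀ (x x′ : Fin 2) k k′ →
    2 * toℕ (opposite x) + k * 3 ≡ 2 * toℕ (opposite x′) + k′ * 3 → x ≡ x′ × k ≡ k′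
  2*+*3-injective 0F 0F k k′ e = refl , *-cancelʳ-≡ k k′ 3 (+-cancelˡ-≡ 2 _ _ e)
  2*+*3-injective 1F 1F k k′ e = refl , *-cancelʳ-≡ k k′ 3 e
  2*+*3-injective 0F 1F zero    (suc _)  ()
  2*+*3-injective 0F 1F (suc k) (suc k′) e =
    contradiction (proj₁ (2*+*3-injective 0F 1F k k′ (+-cancelˡ-≡ 3 _ _ e))) λ ()
  2*+*3-injective 1F 0F (suc _) zero     ()
  2*+*3-injective 1F 0F (suc k) (suc k′) e =
    contradiction (proj₁ (2*+*3-injective 1F 0F k k′ (+-cancelˡ-≡ 3 _ _ e))) λ ()

  total-far-injective : ∀ x (j : Fin n) x′ (j′ : Fin n) →
    total (x , 5 ↑ʳ j) ≡ total (x′ , 5 ↑ʳ j′) → (x , j) ≡ (x′ , j′)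
  total-far-injective x j x′ j′ e =
    let x≡x′ , j≡j′ = 2*+*3-injective x x′ (toℕ j) (toℕ j′)
          (+-cancelˡ-≡ 10 _ _ (trans (sym (total-far x j)) (trans e (total-far x′ j′))))
    in cong₂ _,_ x≡x′ (toℕ-injective j≡j′)

  near≢far : ∀ x (j : Fin 5) x′ (j′ : Fin n) → total (x , j ↑ˡ n) ≢ total (x′ , 5 ↑ʳ j′)
  near≢far x j x′ j′ = <⇒≢ $ ≤-trans (s≤s (total-near x j)) $
    subst (10 ≤_) (sym (total-far x′ j′)) (m≤m+n 10 _)

  -- With columns given as `join 5 n s`, matching on `s` turns them into near or far columns by
  -- computation.
  join-profile-injective : ∀ x s x′ s′ → profile (x , join 5 n s) ↭ profile (x′ , join 5 n s′) →
    (x , join 5 n s) ≡ (x′ , join 5 n s′)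
  join-profile-injective x (inj₁ j) x′ (inj₁ j′) p =
    cong (map₂ (_↑ˡ n)) (energy-injective x j x′ j′ (sum-↭ (map⁺ (λ k → k * k) p)))
  join-profile-injective x (inj₁ j) x′ (inj₂ j′) p = contradiction (sum-↭ p) (near≢far x j x′ j′)
  join-profile-injective x (inj₂ j) x′ (inj₁ j′) p = contradiction (sym (sum-↭ p)) (near≢far x′ j′ x j)
  join-profile-injective x (inj₂ j) x′ (inj₂ j′) p =
    cong (map₂ (5 ↑ʳ_)) (total-far-injective x j x′ j′ (sum-↭ p))

  profile-injective : ∀ u v → profile u ↭ profile v → u ≡ v
  profile-injective (x , y) (x′ , y′) =
    subst₂ (λ y y′ → profile (x , y) ↭ profile (x′ , y′) → (x , y) ≡ (x′ , y′))
      (join-splitAt 5 n y) (join-splitAt 5 n y′)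
      (join-profile-injective x (splitAt 5 y) x′ (splitAt 5 y′))

  Π-resolving : Resolving (ladder (5 + n)) (ladder-connected (5 + n)) Π
  Π-resolving {u} {v} u≢v p =
    u≢v (profile-injective u v (subst₂ _↭_ (rₘₚ≡profile u) (rₘₚ≡profile v) p))

theorem3p4 : (m : ℕ) → 5 ≤ m → IsMpd (ladder m) (ladder-connected m) [ 4 ]
theorem3p4 m 5≤m with m≤n⇒∃[o]m+o≡n 5≤m
... | n , refl =
  (Π , Π-resolving) ,
  -- Two distinct vertices exclude a partition with one part.
  4≤resolving (ladder (5 + n)) (ladder-connected (5 + n)) {0F , 0F} {1F , 0F} λ ()
  where open FourParts n
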